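{- Let $(X,x_0)$ and $(Y,y_0)$ be pointed finite sets, let $\Lambda$ be a finite set of labels, and let $\Phi:\Lambda\to\mathrm{Part}(X)$ and $\Psi:\Lambda\to\mathrm{Part}(Y)$ be two maps (partition-semilattice recognizers). With $Z$, $L_X$, $L_Y$ as defined in the context, define $\Theta:\Lambda\to\mathrm{Part}(Z)$ by \[ \Theta(\lambda)=L_X(\Phi(\lambda))\vee L_Y(\Psi(\lambda)). \] Then, for every $S\subseteq\Lambda$, \[ \widehat\Theta(S)=\mathbf 1_Z\quad\Longleftrightarrow\quad \widehat\Phi(S)=\mathbf 1_X\ \text{ or }\ \widehat\Psi(S)=\mathbf 1_Y . \] Equivalently, \[ \widehat\Theta(S)\neq\mathbf 1_Z\quad\Longleftrightarrow\quad \widehat\Phi(S)\neq\mathbf 1_X\ \text{ and }\ \widehat\Psi(S)\neq\mathbf 1_Y . \]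
   Context: For a finite set $W$, $\mathrm{Part}(W)$ is the set of partitions of $W$, ordered by refinement ($\pi\preceq\sigma$ iff every block of $\pi$ is contained in a block of $\sigma$). The join of a family is the finest partition coarser than all its members; the join of the empty family is the discrete partition $\mathbf 0_W$; $\mathbf 1_W=\{W\}$ is the one-block partition. A partition-semilattice recognizer with ground set $W$ is a map $\Phi:\Lambda\to\mathrm{Part}(W)$; for $S\subseteq\Lambda$ one writes $\widehat\Phi(S)=\bigvee_{\lambda\in S}\Phi(\lambda)$ (and likewise for $\Psi$, $\Theta$). Pointed lifts. Let $X^\circ=X\setminus\{x_0\}$, $Y^\circ=Y\setminus\{y_0\}$ and $Z=\{z_0\}\cup(X^\circ\times Y^\circ)$, where $z_0$ is a new point. For $\alpha\in\mathrm{Part}(X)$ let $A_0$ be the block of $\alpha$ containing $x_0$; $L_X(\alpha)\in\mathrm{Part}(Z)$ is the partition whose blocks are $\{z_0\}\cup\bigl((A_0\setminus\{x_0\})\times Y^\circ\bigr)$ and the sets $A\times\{y\}$ for every block $A\in\alpha\setminus\{A_0\}$ and every $y\in Y^\circ$. Symmetrically, for $\beta\in\mathrm{Part}(Y)$ with $B_0$ the block containing $y_0$, $L_Y(\beta)\in\mathrm{Part}(Z)$ has blocks $\{z_0\}\cup\bigl(X^\circ\times(B_0\setminus\{y_0\})\bigr)$ and $\{x\}\times B$ for every $B\in\beta\setminus\{B_0\}$ and every $x\in X^\circ$. -}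

module Defs where

open import Data.Bool.Base using (Bool; true; false; if_then_else_; _∧_)
import Data.Bool.Properties as Bool
open import Data.List.Base
  using (List; []; _∷_; map; mapMaybe; filter; cartesianProduct)
import Data.List.Membership.Propositional as List
import Data.List.Membership.Propositional.Properties as List
open import Data.List.Relation.Unary.All as All using (All)
open import Data.List.Relation.Unary.Any as Any using (Any; here; there)
import Data.List.Relation.Unary.Any.Properties as Any
open import Data.List.Relation.Unary.Enumerates.Setoid using (IsEnumeration)
open import Data.Maybe.Base using (Maybe; nothing; just)
import Data.Maybe.Properties as Maybe
import Data.Maybe.Relation.Unary.Any as MaybeAny
open import Data.Irrelevant using ([_])
open import Data.Product.Base using (_×_; _,_; ∃-syntax; proj₁; proj₂)
import Data.Product.Properties as Product
open import Data.Refinement as Refinement using (Refinement; value; _,_)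
open import Data.Sum.Base using (_⊎_; inj₁; inj₂)
open import Function.Base using (const)
open import Function.Bundles using (_⇔_; mk⇔; Equivalence)
open import Level using (0ℓ)
open import Relation.Binary.Construct.Closure.Equivalence as EqC using (EqClosure)
import Relation.Binary.Construct.Closure.ReflexiveTransitive as Star
open import Relation.Binary.Construct.Closure.Symmetric using (fwd; bwd)
open import Relation.Binary.Core using (Rel)
open import Relation.Binary.Definitions using (Decidable; DecidableEquality)
open import Relation.Binary.PropositionalEquality
  using (_≡_; _≢_; _≗_; refl; sym; trans; cong; subst; setoid)
open import Relation.Nullary using (¬_; Dec; yes; no; does; contradiction; contradiction-irr)
open import Relation.Nullary.Decidable using (map′; dec-true; _×-dec_)

-- The list may contain repetitions.
record FinSet : Set₁ where
  field
    Carrier  : Set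
    _≟_      : DecidableEquality Carrier
    elements : List Carrier
    complete : IsEnumeration (setoid Carrier) elements

∣_∣ : FinSet → Set
∣ W ∣ = FinSet.Carrier W

-- Subsets of a finite set are given by characteristic functions; equality
-- of subsets is pointwise equality _≗_.
Subset : FinSet → Set
Subset W = ∣ W ∣ → Bool

module _ {W : Set} where

  infix 4 _∈_ _⊆_

  _∈_ : W → (W → Bool) → Set
  x ∈ A = A x ≡ true

  _⊆_ : (W → Bool) → (W → Bool) → Set
  A ⊆ B = ∀ {x} → x ∈ A → x ∈ B

  ⊆-antisym : ∀ {A B} → A ⊆ B → B ⊆ A → A ≗ B
  ⊆-antisym {A} {B} A⊆B B⊆A x with A x in p | B x in q
  ... | true  | true  = refl
  ... | false | false = refl
  ... | true  | false = trans (sym (A⊆B p)) q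
  ... | false | true  = trans (sym p) (B⊆A q)

∧⁺ : ∀ {a b} → a ≡ true → b ≡ true → a ∧ b ≡ true
∧⁺ refl refl = refl

∧⁻ : ∀ {a b} → a ∧ b ≡ true → a ≡ true × b ≡ true
∧⁻ {true} {true} _ = refl , refl

does⁻ : {P : Set} (P? : Dec P) → does P? ≡ true → P
does⁻ (yes p) _ = p

-- A partition is its set of blocks: a predicate on subsets that respects
-- equality of subsets.
record Part (W : FinSet) : Set₁ where
  field
    Block    : Subset W → Set
    resp     : ∀ {A B} → A ≗ B → Block A → Block B
    nonempty : ∀ {A} → Block A → ∃[ x ] x ∈ A
    cover    : ∀ x → ∃[ A ] (Block A × x ∈ A)
    disjoint : ∀ {A B x} → Block A → Block B →
               x ∈ A → x ∈ B → A ≗ B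

  block : ∣ W ∣ → Subset W
  block x = proj₁ (cover x)

  block-isBlock : ∀ x → Block (block x)
  block-isBlock x = proj₁ (proj₂ (cover x))

  ∈-block : ∀ x → x ∈ block x
  ∈-block x = proj₂ (proj₂ (cover x))

open Part

module _ {W : FinSet} where

  infix 4 _≋_ _⪯_

  _≋_ : Part W → Part W → Set
  π ≋ σ = ∀ A → Block π A ⇔ Block σ A

  _⪯_ : Part W → Part W → Set
  π ⪯ σ = ∀ {A} → Block π A → ∃[ B ] (Block σ B × A ⊆ B)

  ⪯-antisym : ∀ {π σ} → π ⪯ σ → σ ⪯ π → π ≋ σ
  ⪯-antisym {π} {σ} p q A = mk⇔ (go π σ p q) (go σ π q p)
    where
    go : ∀ π σ → π ⪯ σ → σ ⪯ π → ∀ {A} → Block π A → Block σ A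
    go π σ p q {A} a
      with B , b , A⊆B ← p a
      with C , c , B⊆C ← q b
      with x , x∈A ← nonempty π a
      = resp σ (⊆-antisym
                 (λ {y} y∈B → trans (disjoint π a c x∈A (B⊆C (A⊆B x∈A)) y) (B⊆C y∈B))
                 A⊆B) b

-- The point only witnesses that W is nonempty, so that W is a legitimate block.
𝟏 : (W : FinSet) → ∣ W ∣ → Part W
𝟏 W w₀ = record
  { Block    = λ A → A ≗ const true
  ; resp     = λ A≗B A≗1 x → trans (sym (A≗B x)) (A≗1 x)
  ; nonempty = λ A≗1 → w₀ , A≗1 w₀
  ; cover    = λ x → const true , (λ _ → refl) , refl
  ; disjoint = λ A≗1 B≗1 _ _ x → trans (A≗1 x) (sym (B≗1 x))
  }

-- The equivalence closure of a decidable relation on a finite set is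
-- decidable: rep merges the two classes of each related pair in turn.
module _ (W : FinSet) {R : Rel ∣ W ∣ 0ℓ} (R? : Decidable R) where

  open FinSet W using (_≟_; elements; complete)

  private
    rep : List (∣ W ∣ × ∣ W ∣) → ∣ W ∣ → ∣ W ∣
    rep []             w = w
    rep ((a , b) ∷ ps) w with rep ps w ≟ rep ps a
    ... | yes _ = rep ps b
    ... | no  _ = rep ps w

    rep-cong : ∀ p ps {x y} → rep ps x ≡ rep ps y → rep (p ∷ ps) x ≡ rep (p ∷ ps) y
    rep-cong (a , b) ps {x} {y} e with rep ps x ≟ rep ps a | rep ps y ≟ rep ps a
    ... | yes _ | yes _ = refl
    ... | no  _ | no  _ = e
    ... | yes p | no ¬q = contradiction (trans (sym e) p) ¬q
    ... | no ¬p | yes q = contradiction (trans e q) ¬p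

    rep-merge : ∀ ps {a b} → (a , b) List.∈ ps → rep ps a ≡ rep ps b
    rep-merge ((a , b) ∷ ps) (here refl)
      with rep ps a ≟ rep ps a | rep ps b ≟ rep ps a
    ... | yes _ | yes _ = refl
    ... | yes _ | no  _ = refl
    ... | no ¬p | _     = contradiction refl ¬p
    rep-merge (p ∷ ps) (there i) = rep-cong p ps (rep-merge ps i)

    rep-sound : ∀ ps → All (λ p → R (proj₁ p) (proj₂ p)) ps →
                ∀ w → EqClosure R w (rep ps w)
    rep-sound [] _ w = Star.ε
    rep-sound ((a , b) ∷ ps) (r All.∷ rs) w with rep ps w ≟ rep ps a
    ... | no  _ = rep-sound ps rs w
    ... | yes e =
      subst (EqClosure R w) e (rep-sound ps rs w) Star.◅◅
      EqC.symmetric R (rep-sound ps rs a) Star.◅◅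
      (fwd r Star.◅ rep-sound ps rs b)

    related? : (p : ∣ W ∣ × ∣ W ∣) → Dec (R (proj₁ p) (proj₂ p))
    related? (x , y) = R? x y

    pairs : List (∣ W ∣ × ∣ W ∣)
    pairs = filter related? (cartesianProduct elements elements)

    pairs-sound : ∀ qs → All (λ p → R (proj₁ p) (proj₂ p)) (filter related? qs)
    pairs-sound qs = All.tabulate (λ i → proj₂ (List.∈-filter⁻ related? {xs = qs} i))

    pairs-complete : ∀ {x y} → R x y → (x , y) List.∈ pairs
    pairs-complete {x} {y} r =
      List.∈-filter⁺ related? (List.∈-cartesianProduct⁺ (complete x) (complete y)) r

    rep-complete : ∀ {x y} → EqClosure R x y → rep pairs x ≡ rep pairs y
    rep-complete Star.ε           = refl
    rep-complete (fwd r Star.◅ c) =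
      trans (rep-merge pairs (pairs-complete r)) (rep-complete c)
    rep-complete (bwd r Star.◅ c) =
      trans (sym (rep-merge pairs (pairs-complete r))) (rep-complete c)

  eqClosure? : Decidable (EqClosure R)
  eqClosure? x y = map′ sound rep-complete (rep pairs x ≟ rep pairs y)
    where
    s : ∀ w → EqClosure R w (rep pairs w)
    s = rep-sound pairs (pairs-sound (cartesianProduct elements elements))

    sound : rep pairs x ≡ rep pairs y → EqClosure R x y
    sound e = subst (EqClosure R x) e (s x) Star.◅◅ EqC.symmetric R (s y)

module _ {W : FinSet} where

  Together : Part W → Rel ∣ W ∣ 0ℓ
  Together π x y = ∃[ A ] (Block π A × x ∈ A × y ∈ A)

  together? : ∀ π → Decidable (Together π)
  together? π x y = map′
    (λ y∈ → block π x , block-isBlock π x , ∈-block π x , y∈)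
    (λ (A , a , x∈A , y∈A) → trans (disjoint π (block-isBlock π x) a (∈-block π x) x∈A y) y∈A)
    (block π x y Bool.≟ true)

module _ (Λ : FinSet) {W : FinSet} (S : Subset Λ) (Φ : ∣ Λ ∣ → Part W) where

  open FinSet Λ using () renaming (elements to labels; complete to labels-complete)

  IsJoin : Part W → Set₁
  IsJoin σ = (∀ {l} → l ∈ S → Φ l ⪯ σ)
           × (∀ τ → (∀ {l} → l ∈ S → Φ l ⪯ τ) → σ ⪯ τ)

  Linked : Rel ∣ W ∣ 0ℓ
  Linked x y = ∃[ l ] (l ∈ S × Together (Φ l) x y)

  linked? : Decidable Linked
  linked? x y = map′ Any.satisfied (λ (l , p) → List.lose (labels-complete l) p)
    (Any.any? (λ l → (S l Bool.≟ true) ×-dec together? (Φ l) x y) labels)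

  private
    _~_ : Rel ∣ W ∣ 0ℓ
    _~_ = EqClosure Linked

    _~?_ : Decidable _~_
    _~?_ = eqClosure? W linked?

    ~-sym : ∀ {x y} → x ~ y → y ~ x
    ~-sym = EqC.symmetric Linked

    class : ∣ W ∣ → Subset W
    class x y = does (x ~? y)

    class⇔ : ∀ x y → y ∈ class x ⇔ x ~ y
    class⇔ x y = mk⇔ (does⁻ (x ~? y)) (dec-true (x ~? y))

  -- ⋁-isJoin below shows that this is the finest partition coarser than
  -- every Φ l with l ∈ S.
  ⋁ : Part W
  ⋁ = record
    { Block    = IsClass
    ; resp     = λ A≗B (x , h) → x , λ y → mk⇔
        (λ y∈B → to (h y) (trans (A≗B y) y∈B))
        (λ x~y → trans (sym (A≗B y)) (from (h y) x~y))
    ; nonempty = λ (x , h) → x , from (h x) Star.ε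
    ; cover    = λ x → class x , (x , class⇔ x) , from (class⇔ x x) Star.ε
    ; disjoint = λ {A} {B} (a , h) (b , k) x∈A x∈B →
        ⊆-antisym {A = A} {B}
          (λ {y} y∈A → from (k y)
            (to (k _) x∈B Star.◅◅ ~-sym (to (h _) x∈A) Star.◅◅ to (h y) y∈A))
          (λ {y} y∈B → from (h y)
            (to (h _) x∈A Star.◅◅ ~-sym (to (k _) x∈B) Star.◅◅ to (k y) y∈B))
    }
    where
    open Equivalence

    IsClass : Subset W → Set
    IsClass A = ∃[ x ] (∀ y → y ∈ A ⇔ EqClosure Linked x y)

  ⋁-isJoin : IsJoin ⋁
  ⋁-isJoin = upper , least
    where
    open Equivalence

    upper : ∀ {l} → l ∈ S → Φ l ⪯ ⋁
    upper {l} l∈S {A} a with x , x∈A ← nonempty (Φ l) a =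
      class x , (x , class⇔ x) ,
      λ {y} y∈A → from (class⇔ x y) (fwd (l , l∈S , A , a , x∈A , y∈A) Star.◅ Star.ε)

    least : ∀ τ → (∀ {l} → l ∈ S → Φ l ⪯ τ) → ⋁ ⪯ τ
    least τ Φ⪯τ {A} (x , h) = block τ x , block-isBlock τ x ,
      λ {y} y∈A → go (∈-block τ x) (to (h y) y∈A)
      where
      B = block τ x

      step : ∀ {u v} → Linked u v →
             (u ∈ B → v ∈ B) × (v ∈ B → u ∈ B)
      step (l , l∈S , C , c , u∈C , v∈C) with D , d , C⊆D ← Φ⪯τ l∈S c =
        (λ u∈B → trans (disjoint τ (block-isBlock τ x) d u∈B (C⊆D u∈C) _) (C⊆D v∈C)) ,
        (λ v∈B → trans (disjoint τ (block-isBlock τ x) d v∈B (C⊆D v∈C) _) (C⊆D u∈C))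

      go : ∀ {u v} → u ∈ B → u ~ v → v ∈ B
      go u∈B Star.ε            = u∈B
      go u∈B (fwd r Star.◅ c)  = go (proj₁ (step r) u∈B) c
      go u∈B (bwd r Star.◅ c)  = go (proj₂ (step r) u∈B) c

𝟚 : FinSet
𝟚 = record
  { Carrier  = Bool
  ; _≟_      = Bool._≟_
  ; elements = true ∷ false ∷ []
  ; complete = λ { true → here refl ; false → there (here refl) }
  }

infixr 6 _∨_

_∨_ : {W : FinSet} → Part W → Part W → Part W
π ∨ σ = ⋁ 𝟚 (const true) (λ b → if b then π else σ)

-- X° = X ∖ {x₀}; the proof of x ≢ x₀ is irrelevant, so elements of X° are
-- equal as soon as their values are.
infixl 8 _∖_

_∖_ : (W : FinSet) → ∣ W ∣ → FinSet
W ∖ w₀ = record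
  { Carrier  = Refinement ∣ W ∣ (_≢ w₀)
  ; _≟_      = λ u v → map′ Refinement.value-injective (cong value) (value u ≟ value v)
  ; elements = mapMaybe punctured elements
  ; complete = λ w → Any.mapMaybe⁺ punctured elements
      (Any.map⁺ (Any.map (λ { refl → punctured-complete w }) (complete (value w))))
  }
  where
  open FinSet W

  punctured : ∣ W ∣ → Maybe (Refinement ∣ W ∣ (_≢ w₀))
  punctured w with w ≟ w₀
  ... | yes _   = nothing
  ... | no w≢w₀ = just (w , [ w≢w₀ ])

  punctured-complete : ∀ w → MaybeAny.Any (w ≡_) (punctured (value w))
  punctured-complete (w , [ w≢w₀ ]) with w ≟ w₀
  ... | yes e = contradiction-irr w≢w₀ (contradiction e)
  ... | no  _ = MaybeAny.just refl

module PointedLifts (X Y : FinSet) (x₀ : ∣ X ∣) (y₀ : ∣ Y ∣) where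

  X° Y° : FinSet
  X° = X ∖ x₀
  Y° = Y ∖ y₀

  private
    module X° = FinSet X°
    module Y° = FinSet Y°

  pattern z₀ = nothing

  Z : FinSet
  Z = record
    { Carrier  = Maybe (∣ X° ∣ × ∣ Y° ∣)
    ; _≟_      = Maybe.≡-dec (Product.≡-dec X°._≟_ Y°._≟_)
    ; elements = z₀ ∷ map just (cartesianProduct X°.elements Y°.elements)
    ; complete = λ
        { z₀             → here refl
        ; (just (x , y)) → there (List.∈-map⁺ just
            (List.∈-cartesianProduct⁺ (X°.complete x) (Y°.complete y)))
        }
    }

  -- {z₀} ∪ ((A ∖ {x₀}) × Y°)
  coreX : Subset X → Subset Z
  coreX A z₀             = true
  coreX A (just (x , y)) = A (value x)

  -- A × {y}, for A not containing x₀
  sliceX : Subset X → ∣ Y° ∣ → Subset Z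
  sliceX A y z₀              = false
  sliceX A y (just (x , y′)) = A (value x) ∧ does (y′ Y°.≟ y)

  -- {z₀} ∪ (X° × (B ∖ {y₀}))
  coreY : Subset Y → Subset Z
  coreY B z₀             = true
  coreY B (just (x , y)) = B (value y)

  -- {x} × B, for B not containing y₀
  sliceY : ∣ X° ∣ → Subset Y → Subset Z
  sliceY x B z₀              = false
  sliceY x B (just (x′ , y)) = does (x′ X°.≟ x) ∧ B (value y)

  L_X : Part X → Part Z
  L_X α = record
    { Block    = IsBlock
    ; resp     = λ
        { C≗D (inj₁ e)               → inj₁ λ z → trans (sym (C≗D z)) (e z)
        ; C≗D (inj₂ (A , y , a , n , e)) →
            inj₂ (A , y , a , n , λ z → trans (sym (C≗D z)) (e z))
        }
    ; nonempty = λ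
        { (inj₁ e) → z₀ , e z₀
        ; (inj₂ (A , y , a , n , e)) →
            let x , x∈A = nonempty α a
                x≢x₀ = λ { refl → n (disjoint α a (block-isBlock α x₀) x∈A (∈-block α x₀)) }
                z = just ((x , [ x≢x₀ ]) , y)
            in z , trans (e z) (∧⁺ x∈A (dec-true (y Y°.≟ y) refl))
        }
    ; cover    = covered
    ; disjoint = disj
    }
    where
    A₀ : Subset X
    A₀ = block α x₀

    IsSlice : Subset Z → Set
    IsSlice C = ∃[ A ] ∃[ y ] (Block α A × ¬ (A ≗ A₀) × C ≗ sliceX A y)

    IsBlock : Subset Z → Set
    IsBlock C = C ≗ coreX A₀ ⊎ IsSlice C

    covered : ∀ z → ∃[ C ] (IsBlock C × z ∈ C)
    covered z₀ = coreX A₀ , inj₁ (λ _ → refl) , refl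
    covered (just (x , y)) with A₀ (value x) in p
    ... | true  = coreX A₀ , inj₁ (λ _ → refl) , p
    ... | false = sliceX A y ,
        inj₂ (A , y , block-isBlock α (value x) , A≇A₀ , λ _ → refl) ,
        ∧⁺ (∈-block α (value x)) (dec-true (y Y°.≟ y) refl)
      where
      A = block α (value x)
      A≇A₀ : ¬ (A ≗ A₀)
      A≇A₀ e with () ← trans (sym (∈-block α (value x))) (trans (e (value x)) p)

    apart : ∀ {C D} z → C ≗ coreX A₀ → IsSlice D → z ∈ C → ¬ (z ∈ D)
    apart z₀ e (A , y , a , n , f) _ q with () ← trans (sym q) (f z₀)
    apart z@(just _) e (A , y , a , n , f) p q =
      n (disjoint α a (block-isBlock α x₀)
          (proj₁ (∧⁻ (trans (sym (f z)) q))) (trans (sym (e z)) p))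

    disj : ∀ {C D z} → IsBlock C → IsBlock D → z ∈ C → z ∈ D → C ≗ D
    disj (inj₁ e) (inj₁ f) _ _ z = trans (e z) (sym (f z))
    disj (inj₁ e) (inj₂ d) p q = contradiction q (apart _ e d p)
    disj (inj₂ c) (inj₁ f) p q = contradiction p (apart _ f c q)
    disj {z = z₀} (inj₂ (A , y , a , n , e)) (inj₂ _) p q with () ← trans (sym p) (e z₀)
    disj {z = z@(just (x , y″))} (inj₂ (A , y , a , n , e)) (inj₂ (B , y′ , b , m , f)) p q
      with x∈A , i ← ∧⁻ {A (value x)} (trans (sym (e z)) p)
      with x∈B , j ← ∧⁻ {B (value x)} (trans (sym (f z)) q)
      with refl ← does⁻ (y″ Y°.≟ y) i
      with refl ← does⁻ (y″ Y°.≟ y′) j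
      = λ w → trans (e w) (trans (same w) (sym (f w)))
      where
      same : sliceX A y ≗ sliceX B y
      same z₀             = refl
      same (just (u , v)) = cong (_∧ does (v Y°.≟ y)) (disjoint α a b x∈A x∈B (value u))

  L_Y : Part Y → Part Z
  L_Y β = record
    { Block    = IsBlock
    ; resp     = λ
        { C≗D (inj₁ e)               → inj₁ λ z → trans (sym (C≗D z)) (e z)
        ; C≗D (inj₂ (x , B , b , n , e)) →
            inj₂ (x , B , b , n , λ z → trans (sym (C≗D z)) (e z))
        }
    ; nonempty = λ
        { (inj₁ e) → z₀ , e z₀
        ; (inj₂ (x , B , b , n , e)) →
            let y , y∈B = nonempty β b
                y≢y₀ = λ { refl → n (disjoint β b (block-isBlock β y₀) y∈B (∈-block β y₀)) }
                z = just (x , (y , [ y≢y₀ ]))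
            in z , trans (e z) (∧⁺ (dec-true (x X°.≟ x) refl) y∈B)
        }
    ; cover    = covered
    ; disjoint = disj
    }
    where
    B₀ : Subset Y
    B₀ = block β y₀

    IsSlice : Subset Z → Set
    IsSlice C = ∃[ x ] ∃[ B ] (Block β B × ¬ (B ≗ B₀) × C ≗ sliceY x B)

    IsBlock : Subset Z → Set
    IsBlock C = C ≗ coreY B₀ ⊎ IsSlice C

    covered : ∀ z → ∃[ C ] (IsBlock C × z ∈ C)
    covered z₀ = coreY B₀ , inj₁ (λ _ → refl) , refl
    covered (just (x , y)) with B₀ (value y) in p
    ... | true  = coreY B₀ , inj₁ (λ _ → refl) , p
    ... | false = sliceY x B ,
        inj₂ (x , B , block-isBlock β (value y) , B≇B₀ , λ _ → refl) ,
        ∧⁺ (dec-true (x X°.≟ x) refl) (∈-block β (value y))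
      where
      B = block β (value y)
      B≇B₀ : ¬ (B ≗ B₀)
      B≇B₀ e with () ← trans (sym (∈-block β (value y))) (trans (e (value y)) p)

    apart : ∀ {C D} z → C ≗ coreY B₀ → IsSlice D → z ∈ C → ¬ (z ∈ D)
    apart z₀ e (x , B , b , n , f) _ q with () ← trans (sym q) (f z₀)
    apart z@(just (x′ , y)) e (x , B , b , n , f) p q =
      n (disjoint β b (block-isBlock β y₀)
          (proj₂ (∧⁻ {does (x′ X°.≟ x)} (trans (sym (f z)) q))) (trans (sym (e z)) p))

    disj : ∀ {C D z} → IsBlock C → IsBlock D → z ∈ C → z ∈ D → C ≗ D
    disj (inj₁ e) (inj₁ f) _ _ z = trans (e z) (sym (f z))
    disj (inj₁ e) (inj₂ d) p q = contradiction q (apart _ e d p)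
    disj (inj₂ c) (inj₁ f) p q = contradiction p (apart _ f c q)
    disj {z = z₀} (inj₂ (x , B , b , n , e)) (inj₂ _) p q with () ← trans (sym p) (e z₀)
    disj {z = z@(just (x″ , y))} (inj₂ (x , B , b , n , e)) (inj₂ (x′ , C , c , m , f)) p q
      with i , y∈B ← ∧⁻ {does (x″ X°.≟ x)} (trans (sym (e z)) p)
      with j , y∈C ← ∧⁻ {does (x″ X°.≟ x′)} (trans (sym (f z)) q)
      with refl ← does⁻ (x″ X°.≟ x) i
      with refl ← does⁻ (x″ X°.≟ x′) j
      = λ w → trans (e w) (trans (same w) (sym (f w)))
      where
      same : sliceY x B ≗ sliceY x C
      same z₀             = refl
      same (just (u , v)) = cong (does (u X°.≟ x) ∧_) (disjoint β b c y∈B y∈C (value v))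

  Θ : {Λ : Set} → (Λ → Part X) → (Λ → Part Y) → Λ → Part Z
  Θ Φ Ψ l = L_X (Φ l) ∨ L_Y (Ψ l)

{-# OPTIONS --safe #-}

-- The set of all points (x , y) with x joined to x₀ or y joined to y₀,
-- together with z₀, is a union of blocks of every Θ l with l ∈ S.  So if Z
-- is joined into one block, a single x not joined to x₀ forces every y to be
-- joined to y₀.  Conversely, a path from x₀ to x in X is copied into the
-- fibre over any y, with x₀ placed at z₀.

module Submission where

open import Defs
open import Data.Bool.Base using (true; false; if_then_else_)
open import Data.Irrelevant using ([_])
import Data.List.Relation.Unary.All as All
import Data.List.Relation.Unary.All.Properties as All
import Data.List.Relation.Unary.Any as Any
open import Data.Maybe.Base using (just)
open import Data.Product.Base using (_×_; _,_; proj₁)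
open import Data.Refinement using (value; _,_)
open import Data.Sum.Base as Sum using (_⊎_; inj₁; inj₂; [_,_]′; map₁; map₂)
open import Data.Unit.Base using (⊤; tt)
open import Function.Base using (_∘_; const; id)
open import Function.Bundles using (_⇔_; mk⇔; Equivalence)
open import Function.Properties.Equivalence using (⇔-isEquivalence)
open import Level using (0ℓ)
open import Relation.Binary.Construct.Closure.Equivalence as EqC using (EqClosure)
open import Relation.Binary.Construct.Closure.ReflexiveTransitive as Star using (_◅◅_)
open import Relation.Binary.Core using (Rel; _⇒_; _=[_]⇒_)
open import Relation.Binary.Definitions using (Symmetric; _Respects_)
open import Relation.Binary.PropositionalEquality
  using (_≡_; _≗_; refl; sym; trans; subst₂)
open import Relation.Nullary using (¬_; yes; no; does; contradiction; contradiction-irr)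
open import Relation.Nullary.Decidable using (dec-true)
open import Relation.Unary using (Pred; Decidable; Universal)

open Part
open Equivalence

together-sym : ∀ {W} (π : Part W) → Symmetric (Together π)
together-sym π (A , a , x∈A , y∈A) = A , a , y∈A , x∈A

⪯⇒together : ∀ {W} (π σ : Part W) → π ⪯ σ → Together π ⇒ Together σ
⪯⇒together _ _ π⪯σ (A , a , x∈A , y∈A) with B , b , A⊆B ← π⪯σ a =
  B , b , A⊆B x∈A , A⊆B y∈A

-- Constructively, finiteness of `W` and decidability of `P` give either all of `P` or a concrete
-- `w` outside `P`; this one `w` then forces `Q` at every `v`.
universal-⊎ : (W : FinSet) {V : Set} {P : Pred ∣ W ∣ 0ℓ} {Q : Pred V 0ℓ} → Decidable P →
              (∀ w v → P w ⊎ Q v) → Universal P ⊎ Universal Q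
universal-⊎ W P? P⊎Q with All.all? P? elements
  where open FinSet W
... | yes all = inj₁ (λ w → All.lookup all (FinSet.complete W w))
... | no ¬all with w , ¬p ← Any.satisfied (All.¬All⇒Any¬ P? _ ¬all) =
  inj₂ (λ v → [ (λ p → contradiction p ¬p) , id ]′ (P⊎Q w v))

module _ (Λ : FinSet) {W : FinSet} (S : Subset Λ) (Φ : ∣ Λ ∣ → Part W) where

  together-⋁⇒ : Together (⋁ Λ S Φ) ⇒ EqClosure (Linked Λ S Φ)
  together-⋁⇒ (A , (a , h) , x∈A , y∈A) =
    EqC.symmetric _ (to (h _) x∈A) ◅◅ to (h _) y∈A

  -- This trades equality of partitions for reachability from the base point, so that the rest of
  -- the argument handles only paths of `Linked` pairs.
  ⋁≋𝟏⇔ : ∀ w₀ → ⋁ Λ S Φ ≋ 𝟏 W w₀ ⇔ Universal (EqClosure (Linked Λ S Φ) w₀)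
  ⋁≋𝟏⇔ w₀ = mk⇔ joined one
    where
    joined : ⋁ Λ S Φ ≋ 𝟏 W w₀ → Universal (EqClosure (Linked Λ S Φ) w₀)
    joined e w = together-⋁⇒ (const true , from (e (const true)) (λ _ → refl) , refl , refl)

    one : Universal (EqClosure (Linked Λ S Φ) w₀) → ⋁ Λ S Φ ≋ 𝟏 W w₀
    one c A = mk⇔
      (λ (x , h) y → from (h y) (EqC.symmetric _ (c x) ◅◅ c y))
      (λ A≗1 → w₀ , λ y → mk⇔ (λ _ → c y) (λ _ → A≗1 y))

-- By symmetry `P` is equivalent at the two ends of every edge, and `⇔` is an equivalence relation,
-- so the equivalence folds along any path.
respects-eqClosure : {A : Set} {P : Pred A 0ℓ} {R : Rel A 0ℓ} → Symmetric R →
                     P Respects R → P Respects EqClosure R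
respects-eqClosure {P = P} R-sym resp c =
  to (EqC.gfold ⇔-isEquivalence P (λ r → mk⇔ (resp r) (resp (R-sym r))) c)

-- A union of blocks of each member of a family is a union of blocks of the join. It serves for the
-- join over `S` and for the binary join inside `Θ`.
respects-⋁ : ∀ (Λ : FinSet) {W} (S : Subset Λ) (Φ : ∣ Λ ∣ → Part W) {P : Pred ∣ W ∣ 0ℓ} →
             (∀ {l} → l ∈ S → P Respects Together (Φ l)) →
             P Respects EqClosure (Linked Λ S Φ)
respects-⋁ Λ S Φ resp = respects-eqClosure
  (λ (l , l∈S , t) → l , l∈S , together-sym (Φ l) t)
  (λ (l , l∈S , t) → resp l∈S t)

module _ {X Y : FinSet} {x₀ : ∣ X ∣} {y₀ : ∣ Y ∣} where

  open PointedLifts X Y x₀ y₀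

  -- `Z` is the smash product of the pointed sets: `X × Y` with both axes collapsed to `z₀`. When
  -- `P x₀` and `Q y₀` hold, this is the image of the union of `P × Y` and `X × Q`.
  Cross : Pred ∣ X ∣ 0ℓ → Pred ∣ Y ∣ 0ℓ → Pred ∣ Z ∣ 0ℓ
  Cross P Q z₀             = ⊤
  Cross P Q (just (x , y)) = P (value x) ⊎ Q (value y)

  module _ {P : Pred ∣ X ∣ 0ℓ} {Q : Pred ∣ Y ∣ 0ℓ} where

    -- In the core block every first coordinate lies with `x₀`, so `P` holds there. In a slice the
    -- second coordinate is constant, so `Q` is kept while `P` moves within a block of `α`.
    cross-L_X : ∀ α → P x₀ → P Respects Together α → Cross P Q Respects Together (L_X α)
    cross-L_X α _ _ {y = z₀} _ _ = tt
    cross-L_X α p resp {y = v@(just (x , y))} (C , inj₁ e , _ , v∈C) _ =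
      -- `P` is transported from `x₀` itself, because the other point may be `z₀` or may satisfy
      -- only the `Q` alternative.
      inj₁ (resp (block α x₀ , block-isBlock α x₀ , ∈-block α x₀ , trans (sym (e v)) v∈C) p)
    cross-L_X α _ _ {x = z₀} (C , inj₂ (A , y , a , n , e) , u∈C , _) _
      with () ← trans (sym u∈C) (e z₀)
    cross-L_X α _ resp {x = u@(just (x , y₁))} {y = v@(just (x′ , y₂))}
              (C , inj₂ (A , y , a , n , e) , u∈C , v∈C) q
      with x∈A , i ← ∧⁻ {A (value x)} (trans (sym (e u)) u∈C)
      with x′∈A , j ← ∧⁻ {A (value x′)} (trans (sym (e v)) v∈C)
      with refl ← does⁻ (FinSet._≟_ Y° y₁ y) i
      with refl ← does⁻ (FinSet._≟_ Y° y₂ y) j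
      = map₁ (resp (A , a , x∈A , x′∈A)) q

    cross-L_Y : ∀ β → Q y₀ → Q Respects Together β → Cross P Q Respects Together (L_Y β)
    cross-L_Y β _ _ {y = z₀} _ _ = tt
    cross-L_Y β q resp {y = v@(just (x , y))} (C , inj₁ e , _ , v∈C) _ =
      inj₂ (resp (block β y₀ , block-isBlock β y₀ , ∈-block β y₀ , trans (sym (e v)) v∈C) q)
    cross-L_Y β _ _ {x = z₀} (C , inj₂ (x , B , b , n , e) , u∈C , _) _
      with () ← trans (sym u∈C) (e z₀)
    cross-L_Y β _ resp {x = u@(just (x₁ , y))} {y = v@(just (x₂ , y′))}
              (C , inj₂ (x , B , b , n , e) , u∈C , v∈C) q
      with i , y∈B ← ∧⁻ {does (FinSet._≟_ X° x₁ x)} (trans (sym (e u)) u∈C)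
      with j , y′∈B ← ∧⁻ {does (FinSet._≟_ X° x₂ x)} (trans (sym (e v)) v∈C)
      with refl ← does⁻ (FinSet._≟_ X° x₁ x) i
      with refl ← does⁻ (FinSet._≟_ X° x₂ x) j
      = map₂ (resp (B , b , y∈B , y′∈B)) q

    -- The pairs on the axes, which `Z` collapses to `z₀`, are covered by `P x₀` and `Q y₀`.
    cross-universal⇒ : P x₀ → Q y₀ → Universal (Cross P Q) → ∀ x y → P x ⊎ Q y
    cross-universal⇒ p q c x y with FinSet._≟_ X x x₀ | FinSet._≟_ Y y y₀
    ... | yes refl | _        = inj₁ p
    ... | no _     | yes refl = inj₂ q
    ... | no x≢x₀  | no y≢y₀  = c (just ((x , [ x≢x₀ ]) , (y , [ y≢y₀ ])))

  -- The inclusion of `X` at height `y`, followed by the collapse of the axes.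
  inFibreX : ∣ Y° ∣ → ∣ X ∣ → ∣ Z ∣
  inFibreX y x with FinSet._≟_ X x x₀
  ... | yes _   = z₀
  ... | no x≢x₀ = just ((x , [ x≢x₀ ]) , y)

  inFibreX-x₀ : ∀ y → inFibreX y x₀ ≡ z₀
  inFibreX-x₀ y with FinSet._≟_ X x₀ x₀
  ... | yes _    = refl
  ... | no x₀≢x₀ = contradiction refl x₀≢x₀

  inFibreX-value : ∀ y x → inFibreX y (value x) ≡ just (x , y)
  inFibreX-value y (x , [ x≢x₀ ]) with FinSet._≟_ X x x₀
  ... | yes x≡x₀ = contradiction-irr x≢x₀ (contradiction x≡x₀)
  ... | no _     = refl

  inFibreY : ∣ X° ∣ → ∣ Y ∣ → ∣ Z ∣
  inFibreY x y with FinSet._≟_ Y y y₀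
  ... | yes _   = z₀
  ... | no y≢y₀ = just (x , (y , [ y≢y₀ ]))

  inFibreY-y₀ : ∀ x → inFibreY x y₀ ≡ z₀
  inFibreY-y₀ x with FinSet._≟_ Y y₀ y₀
  ... | yes _    = refl
  ... | no y₀≢y₀ = contradiction refl y₀≢y₀

  inFibreY-value : ∀ x y → inFibreY x (value y) ≡ just (x , y)
  inFibreY-value x (y , [ y≢y₀ ]) with FinSet._≟_ Y y y₀
  ... | yes y≡y₀ = contradiction-irr y≢y₀ (contradiction y≡y₀)
  ... | no _     = refl

  -- Whether a block contains `x₀` decides its image: a block through `x₀` lands in the core, any
  -- other in its own slice at height `y`.
  inFibreX-together : ∀ α y → Together α =[ inFibreX y ]⇒ Together (L_X α)
  inFibreX-together α y (A , a , u∈A , v∈A) with A x₀ in x₀∈A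
  ... | true  = coreX A₀ , inj₁ (λ _ → refl) , ∈-core u∈A , ∈-core v∈A
    where
    A₀ : Subset X
    A₀ = block α x₀

    ∈-core : ∀ {x} → x ∈ A → inFibreX y x ∈ coreX A₀
    ∈-core {x} x∈A with FinSet._≟_ X x x₀
    ... | yes _ = refl
    ... | no _  = trans (disjoint α (block-isBlock α x₀) a (∈-block α x₀) x₀∈A x) x∈A
  ... | false = sliceX A y , inj₂ (A , y , a , A≇A₀ , λ _ → refl) , ∈-slice u∈A , ∈-slice v∈A
    where
    A≇A₀ : ¬ (A ≗ block α x₀)
    A≇A₀ e with () ← trans (sym x₀∈A) (trans (e x₀) (∈-block α x₀))

    ∈-slice : ∀ {x} → x ∈ A → inFibreX y x ∈ sliceX A y
    ∈-slice {x} x∈A with FinSet._≟_ X x x₀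
    -- A block that becomes a slice misses `x₀`, so none of its points is sent to `z₀`.
    ... | yes refl with () ← trans (sym x∈A) x₀∈A
    ... | no _     = ∧⁺ x∈A (dec-true (FinSet._≟_ Y° y y) refl)

  inFibreY-together : ∀ β x → Together β =[ inFibreY x ]⇒ Together (L_Y β)
  inFibreY-together β x (B , b , u∈B , v∈B) with B y₀ in y₀∈B
  ... | true  = coreY B₀ , inj₁ (λ _ → refl) , ∈-core u∈B , ∈-core v∈B
    where
    B₀ : Subset Y
    B₀ = block β y₀

    ∈-core : ∀ {y} → y ∈ B → inFibreY x y ∈ coreY B₀
    ∈-core {y} y∈B with FinSet._≟_ Y y y₀
    ... | yes _ = refl
    ... | no _  = trans (disjoint β (block-isBlock β y₀) b (∈-block β y₀) y₀∈B y) y∈B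
  ... | false = sliceY x B , inj₂ (x , B , b , B≇B₀ , λ _ → refl) , ∈-slice u∈B , ∈-slice v∈B
    where
    B≇B₀ : ¬ (B ≗ block β y₀)
    B≇B₀ e with () ← trans (sym y₀∈B) (trans (e y₀) (∈-block β y₀))

    ∈-slice : ∀ {y} → y ∈ B → inFibreY x y ∈ sliceY x B
    ∈-slice {y} y∈B with FinSet._≟_ Y y y₀
    ... | yes refl with () ← trans (sym y∈B) y₀∈B
    ... | no _     = ∧⁺ (dec-true (FinSet._≟_ X° x x) refl) y∈B

  module _ (Λ : FinSet) (Φ : ∣ Λ ∣ → Part X) (Ψ : ∣ Λ ∣ → Part Y) (S : Subset Λ) where

    private
      _~X_ : Rel ∣ X ∣ 0ℓ
      _~X_ = EqClosure (Linked Λ S Φ)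

      _~Y_ : Rel ∣ Y ∣ 0ℓ
      _~Y_ = EqClosure (Linked Λ S Ψ)

      _~Z_ : Rel ∣ Z ∣ 0ℓ
      _~Z_ = EqClosure (Linked Λ S (Θ Φ Ψ))

    -- `Θ Φ Ψ l` is by definition the join of this two-member family, so the results on `⋁` apply to
    -- it.
    lifts : ∣ Λ ∣ → ∣ 𝟚 ∣ → Part Z
    lifts l b = if b then L_X (Φ l) else L_Y (Ψ l)

    L_X⪯Θ : ∀ l → L_X (Φ l) ⪯ Θ Φ Ψ l
    L_X⪯Θ l = proj₁ (⋁-isJoin 𝟚 (const true) (lifts l)) {true} refl

    L_Y⪯Θ : ∀ l → L_Y (Ψ l) ⪯ Θ Φ Ψ l
    L_Y⪯Θ l = proj₁ (⋁-isJoin 𝟚 (const true) (lifts l)) {false} refl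

    inFibreX-~ : ∀ y → _~X_ =[ inFibreX y ]⇒ _~Z_
    inFibreX-~ y = EqC.gmap (inFibreX y) λ (l , l∈S , t) →
      l , l∈S , ⪯⇒together (L_X (Φ l)) (Θ Φ Ψ l) (L_X⪯Θ l)
        (inFibreX-together (Φ l) y t)

    inFibreY-~ : ∀ x → _~Y_ =[ inFibreY x ]⇒ _~Z_
    inFibreY-~ x = EqC.gmap (inFibreY x) λ (l , l∈S , t) →
      l , l∈S , ⪯⇒together (L_Y (Ψ l)) (Θ Φ Ψ l) (L_Y⪯Θ l)
        (inFibreY-together (Ψ l) x t)

    joinedX⇒joinedZ : Universal (x₀ ~X_) → Universal (z₀ ~Z_)
    joinedX⇒joinedZ c z₀             = Star.ε
    joinedX⇒joinedZ c (just (x , y)) =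
      -- `inFibreX` branches on a decision, so the ends of the copied path are `z₀` and
      -- `just (x , y)` only up to a propositional equality.
      subst₂ _~Z_ (inFibreX-x₀ y) (inFibreX-value y x) (inFibreX-~ y (c (value x)))

    joinedY⇒joinedZ : Universal (y₀ ~Y_) → Universal (z₀ ~Z_)
    joinedY⇒joinedZ c z₀             = Star.ε
    joinedY⇒joinedZ c (just (x , y)) =
      subst₂ _~Z_ (inFibreY-y₀ x) (inFibreY-value x y) (inFibreY-~ x (c (value y)))

    cross-respects-Θ : Cross (x₀ ~X_) (y₀ ~Y_) Respects _~Z_
    -- The outer use runs over the labels in `S`, the inner one over the two lifts of a label. Each
    -- pair in a block of `Φ l` or `Ψ l` extends a path from the base point by one link.
    cross-respects-Θ = respects-⋁ Λ S (Θ Φ Ψ) λ {l} l∈S t →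
      respects-⋁ 𝟚 (const true) (lifts l)
        (λ { {true}  _ → cross-L_X (Φ l) Star.ε
                           (λ t c → c ◅◅ EqC.return (l , l∈S , t))
           ; {false} _ → cross-L_Y (Ψ l) Star.ε
                           (λ t c → c ◅◅ EqC.return (l , l∈S , t)) })
        (together-⋁⇒ 𝟚 (const true) (lifts l) t)

    joinedZ⇒ : Universal (z₀ ~Z_) → Universal (x₀ ~X_) ⊎ Universal (y₀ ~Y_)
    joinedZ⇒ c = universal-⊎ X (eqClosure? X (linked? Λ S Φ) x₀)
      -- `tt` places `z₀` in the cross, and the path `c z` carries membership on to `z`.
      (cross-universal⇒ Star.ε Star.ε (λ z → cross-respects-Θ (c z) tt))

theorem4p4 : (X Y Λ : FinSet) (x₀ : ∣ X ∣) (y₀ : ∣ Y ∣) →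
    (Φ : ∣ Λ ∣ → Part X) (Ψ : ∣ Λ ∣ → Part Y) →
    let open PointedLifts X Y x₀ y₀ in
    (S : Subset Λ) →
    (⋁ Λ S (Θ Φ Ψ) ≋ 𝟏 Z z₀ ⇔ (⋁ Λ S Φ ≋ 𝟏 X x₀ ⊎ ⋁ Λ S Ψ ≋ 𝟏 Y y₀)) ×
    ((¬ (⋁ Λ S (Θ Φ Ψ) ≋ 𝟏 Z z₀)) ⇔ ((¬ (⋁ Λ S Φ ≋ 𝟏 X x₀)) × (¬ (⋁ Λ S Ψ ≋ 𝟏 Y y₀))))
theorem4p4 X Y Λ x₀ y₀ Φ Ψ S =
  mk⇔ split joined ,
  mk⇔ (λ ¬z → ¬z ∘ joined ∘ inj₁ , ¬z ∘ joined ∘ inj₂)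
      (λ (¬x , ¬y) → [ ¬x , ¬y ]′ ∘ split)
  where
  open PointedLifts X Y x₀ y₀

  X⇔ = ⋁≋𝟏⇔ Λ S Φ x₀
  Y⇔ = ⋁≋𝟏⇔ Λ S Ψ y₀
  Z⇔ = ⋁≋𝟏⇔ Λ S (Θ Φ Ψ) z₀

  split : ⋁ Λ S (Θ Φ Ψ) ≋ 𝟏 Z z₀ → ⋁ Λ S Φ ≋ 𝟏 X x₀ ⊎ ⋁ Λ S Ψ ≋ 𝟏 Y y₀
  split = Sum.map (from X⇔) (from Y⇔) ∘ joinedZ⇒ Λ Φ Ψ S ∘ to Z⇔

  joined : ⋁ Λ S Φ ≋ 𝟏 X x₀ ⊎ ⋁ Λ S Ψ ≋ 𝟏 Y y₀ → ⋁ Λ S (Θ Φ Ψ) ≋ 𝟏 Z z₀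
  joined = from Z⇔ ∘ [ joinedX⇒joinedZ Λ Φ Ψ S ∘ to X⇔ , joinedY⇒joinedZ Λ Φ Ψ S ∘ to Y⇔ ]′
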